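{- Let $k\ge2$ and $n\ge1$ be integers with $k>2^n$. Let $\mathbf s_j=(2^k-1)2^{n+j}-1$ for $j\in\mathbb N$ and let $S_n=\langle\{\mathbf s_j:j\in\mathbb N\}\rangle$, which is a numerical semigroup. Then $$\max\mathrm{Ap}(S_n,\mathbf s_0)=2\mathbf s_{n+k-2^n-1}+\sum_{j=n+k-2^n}^{n+k-1}\mathbf s_j$$ and the Frobenius number of $S_n$ is $$\mathrm F(S_n)=2^{2n+2k}-2^{2n+k}-2^{n+k}-1.$$
   Context: $\mathbb N=\{0,1,2,\ldots\}$. For $A\subseteq\mathbb N$, $\langle A\rangle$ is the submonoid of $(\mathbb N,+)$ generated by $A$. A numerical semigroup is a submonoid $S$ of $\mathbb N$ with finite complement; its Frobenius number $\mathrm F(S)$ is the largest element of $\mathbb N\setminus S$. For $x\in S\setminus\{0\}$, the Apéry set is $\mathrm{Ap}(S,x)=\{y\in S:y-x\notin S\}$. -}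

module Defs where

open import Data.Integer.Base using (+_; _⊖_)
open import Data.List.Base using (applyUpTo)
open import Data.Nat.Base using (ℕ; suc; _+_; _*_; _∸_; _^_; _≤_)
open import Data.Nat.ListAction using (sum)
open import Data.Product.Base using (_×_; ∃-syntax)
open import Function.Bundles using (_⇔_)
open import Level using (0ℓ)
open import Relation.Binary.PropositionalEquality.Core using (_≡_)
open import Relation.Nullary.Negation.Core using (¬_)
open import Relation.Unary using (Pred; _∈_; ∁)
import Data.List.Membership.Propositional as List

data ⟨_⟩ (A : Pred ℕ 0ℓ) : Pred ℕ 0ℓ where
  gen    : ∀ {x} → x ∈ A → x ∈ ⟨ A ⟩
  0-mem  : 0 ∈ ⟨ A ⟩
  +-mem  : ∀ {x y} → x ∈ ⟨ A ⟩ → y ∈ ⟨ A ⟩ → x + y ∈ ⟨ A ⟩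

Finite : Pred (Pred ℕ 0ℓ) 0ℓ
Finite P = ∃[ xs ] (∀ x → x ∈ P ⇔ x List.∈ xs)

record IsNumericalSemigroup (S : Pred ℕ 0ℓ) : Set where
  field
    0∈S      : 0 ∈ S
    +-closed : ∀ {x y} → x ∈ S → y ∈ S → x + y ∈ S
    cofinite : Finite (∁ S)

IsMax : Pred ℕ 0ℓ → ℕ → Set
IsMax P m = m ∈ P × (∀ y → y ∈ P → y ≤ m)

IsFrobeniusNumber : Pred ℕ 0ℓ → ℕ → Set
IsFrobeniusNumber S = IsMax (∁ S)

-- The difference y ⊖ x is taken in ℤ: when y < x it is negative, hence not
-- in S.  Truncated subtraction would wrongly give 0 ∈ S there.
Ap : Pred ℕ 0ℓ → ℕ → Pred ℕ 0ℓ
Ap S x y = y ∈ S × ¬ (∃[ z ] (z ∈ S × y ⊖ x ≡ + z))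

-- Sum of f j over a ≤ j ≤ b (both ends included; 0 if b < a).
∑[_⋯_] : ℕ → ℕ → (ℕ → ℕ) → ℕ
∑[ a ⋯ b ] f = sum (applyUpTo (λ i → f (a + i)) (suc b ∸ a))

-- The subtractions never truncate when k ≥ 1.
s : (k n : ℕ) → ℕ → ℕ
s k n j = (2 ^ k ∸ 1) * 2 ^ (n + j) ∸ 1

S : (k n : ℕ) → Pred ℕ 0ℓ
S k n = ⟨ (λ x → ∃[ j ] x ≡ s k n j) ⟩

{-# OPTIONS --safe #-}
-- Write tⱼ for the generators; they satisfy tⱼ₊₁ = 2 tⱼ + 1, so tⱼ = 2ʲ t₀ + (2ʲ - 1).
-- A sum of N generators whose powers 2ʲ add up to a equals a t₀ + (a - N), and
-- N takes exactly the values between the binary digit sum of a and a.  Hence, by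
-- Legendre's formula, for r < t₀
--   q t₀ + r ∈ S  ⇔  r ≤ ν(q) = ⌊q/2⌋ + ⌊q/4⌋ + ⋯ .
-- As ν is monotone, the largest gap is q t₀ + (t₀ - 1) for the last q with
-- ν(q) < t₀ - 1.  This is q = 2ⁿ⁺ᵏ - 1, because ν(2ᵐ - 1) = 2ᵐ - 1 - m and
-- ν(2ᵐ) = 2ᵐ - 1, while t₀ - 1 = 2ⁿ⁺ᵏ - 2ⁿ - 2 and k > 2ⁿ.  The maximum of the
-- Apéry set is F(S) + t₀.
module Submission where

open import Defs
open import Data.Nat.Base using (ℕ; _+_; _*_; _∸_; _^_; _≥_; _>_)
open import Data.Product.Base using (_×_)

open import Data.Integer.Base using (_⊖_)
import Data.Integer.Base as ℤ
open import Data.Integer.Properties using (⊖-≥; +-injective)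
open import Data.List.Base using (applyUpTo; filter; upTo)
open import Data.List.Membership.Propositional.Properties
  using (∈-filter⁺; ∈-filter⁻; ∈-upTo⁺)
open import Data.Nat.Base
  using (zero; suc; _≤_; _<_; z≤n; s≤s; s≤s⁻¹; ⌊_/2⌋; NonZero; >-nonZero)
open import Data.Nat.DivMod using (_/_; _%_; m≡m%n+[m/n]*n; m%n<n)
open import Data.Nat.ListAction using (sum)
open import Data.Nat.Properties
open import Data.Nat.Tactic.RingSolver using (solve-∀)
open import Data.Product.Base using (_,_; proj₁; proj₂; ∃-syntax)
open import Data.Sum.Base using (inj₁; inj₂)
open import Function.Base using (_∘_)
open import Function.Bundles using (_⇔_; mk⇔; module Equivalence)
open import Level using (0ℓ)
open import Relation.Binary.PropositionalEquality
  using (_≡_; refl; sym; trans; cong; cong₂; subst; module ≡-Reasoning)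
open import Relation.Nullary.Decidable using (decidable-stable; map′; ¬?)
open import Relation.Nullary.Negation.Core using (¬_)
open import Relation.Unary using (Pred; Decidable; _∈_; _∉_; ∁)

-- Finite sets, Frobenius numbers and Apéry sets

bounded⇒finite : ∀ {P : Pred ℕ 0ℓ} → Decidable P → ∀ b → (∀ x → x ∈ P → x ≤ b) → Finite P
bounded⇒finite P? b P≤b = filter P? (upTo (suc b)) , λ x → mk⇔
  (λ x∈P → ∈-filter⁺ P? (∈-upTo⁺ (s≤s (P≤b x x∈P))) x∈P)
  (λ x∈xs → proj₂ (∈-filter⁻ P? {xs = upTo (suc b)} x∈xs))

module _ {A : Pred ℕ 0ℓ} (A? : Decidable A) {f : ℕ} (frob : IsFrobeniusNumber A f) where

  -- Maximality of `f` only refutes `x ∉ A`; decidability turns this into membership.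
  >frobenius⇒∈ : ∀ {x} → f < x → x ∈ A
  >frobenius⇒∈ {x} f<x = decidable-stable (A? x) λ x∉A → <⇒≱ f<x (proj₂ frob x x∉A)

  -- Everything above `f` lies in `A`. So `f + x` is in `A` while removing `x` leaves the gap `f`,
  -- and removing `x` from anything larger leaves an element of `A`.
  frobenius⇒maxAp : ∀ {x} → 0 < x → IsMax (Ap A x) (f + x)
  frobenius⇒maxAp {x} 0<x = (>frobenius⇒∈ (m<m+n f 0<x) , gap) , bound
    where
    gap : ¬ (∃[ z ] (z ∈ A × (f + x) ⊖ x ≡ ℤ.+ z))
    gap (z , z∈A , eq) = proj₁ frob (subst (_∈ A) (sym f≡z) z∈A)
      where
      f≡z : f ≡ z
      f≡z = trans (sym (m+n∸n≡m f x))
                  (+-injective (trans (sym (⊖-≥ (m≤n+m x f))) eq))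

    bound : ∀ y → y ∈ Ap A x → y ≤ f + x
    bound y (_ , y-x∉A) = ≮⇒≥ λ f+x<y → y-x∉A
      ( y ∸ x
      , >frobenius⇒∈ (m+n≤o⇒m≤o∸n (suc f) f+x<y)
      , ⊖-≥ (≤-trans (m≤n+m x f) (<⇒≤ f+x<y)))

-- Legendre's sum

-- ν m a = ⌊a/2⌋ + ⌊a/4⌋ + ⋯ + ⌊a/2ᵐ⌋; for a < 2ᵐ⁺¹ nothing is cut off.
ν : ℕ → ℕ → ℕ
ν zero    a = 0
ν (suc m) a = ⌊ a /2⌋ + ν m ⌊ a /2⌋

ν-mono : ∀ m {a b} → a ≤ b → ν m a ≤ ν m b
ν-mono zero    a≤b = z≤n
ν-mono (suc m) a≤b = +-mono-≤ (⌊n/2⌋-mono a≤b) (ν-mono m (⌊n/2⌋-mono a≤b))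

⌊/2⌋-superadditive : ∀ a b → ⌊ a /2⌋ + ⌊ b /2⌋ ≤ ⌊ a + b /2⌋
⌊/2⌋-superadditive zero          b = ≤-refl
⌊/2⌋-superadditive (suc zero)    b = ⌊n/2⌋-mono (n≤1+n b)
⌊/2⌋-superadditive (suc (suc a)) b = s≤s (⌊/2⌋-superadditive a b)

-- This lets the bound on `e` in `∈T⇒≤ν` survive the addition of two elements.
ν-superadditive : ∀ m a b → ν m a + ν m b ≤ ν m (a + b)
ν-superadditive zero    a b = z≤n
ν-superadditive (suc m) a b = begin
  (⌊ a /2⌋ + ν m ⌊ a /2⌋) + (⌊ b /2⌋ + ν m ⌊ b /2⌋)
    ≡⟨ interchange ⌊ a /2⌋ (ν m ⌊ a /2⌋) ⌊ b /2⌋ (ν m ⌊ b /2⌋) ⟩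
  (⌊ a /2⌋ + ⌊ b /2⌋) + (ν m ⌊ a /2⌋ + ν m ⌊ b /2⌋)
    ≤⟨ +-mono-≤ half (≤-trans (ν-superadditive m ⌊ a /2⌋ ⌊ b /2⌋) (ν-mono m half)) ⟩
  ⌊ a + b /2⌋ + ν m ⌊ a + b /2⌋ ∎
  where
  open ≤-Reasoning
  half : ⌊ a /2⌋ + ⌊ b /2⌋ ≤ ⌊ a + b /2⌋
  half = ⌊/2⌋-superadditive a b
  interchange : ∀ w x y z → (w + x) + (y + z) ≡ (w + y) + (x + z)
  interchange = solve-∀

2*n≡n+n : ∀ n → 2 * n ≡ n + n
2*n≡n+n = solve-∀

⌊2n/2⌋≡n : ∀ n → ⌊ 2 * n /2⌋ ≡ n
⌊2n/2⌋≡n n = trans (cong ⌊_/2⌋ (2*n≡n+n n)) (sym (n≡⌊n+n/2⌋ n))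

⌊1+2n/2⌋≡n : ∀ n → ⌊ suc (2 * n) /2⌋ ≡ n
⌊1+2n/2⌋≡n n = trans (cong (⌊_/2⌋ ∘ suc) (2*n≡n+n n)) (sym (n≡⌈n+n/2⌉ n))

-- The halves of `2 ^ j` form the geometric sum 2^(j-1) + ... + 1; `j ≤ m` ensures that none of them
-- is cut off.
suc-ν-2^ : ∀ {j m} → j ≤ m → suc (ν m (2 ^ j)) ≡ 2 ^ j
suc-ν-2^ {m = zero}  z≤n = refl
suc-ν-2^ {m = suc m} z≤n = cong suc (ν-0 m)
  where
  ν-0 : ∀ m → ν m 0 ≡ 0
  ν-0 zero    = refl
  ν-0 (suc m) = ν-0 m
suc-ν-2^ {suc j} {suc m} (s≤s j≤m) rewrite ⌊2n/2⌋≡n (2 ^ j) = begin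
  suc (2 ^ j + ν m (2 ^ j))  ≡⟨ +-suc (2 ^ j) _ ⟨
  2 ^ j + suc (ν m (2 ^ j))  ≡⟨ cong (2 ^ j +_) (suc-ν-2^ j≤m) ⟩
  2 ^ j + 2 ^ j              ≡⟨ 2*n≡n+n (2 ^ j) ⟨
  2 * 2 ^ j                  ∎
  where open ≡-Reasoning

-- By Legendre, `ν m a` is `a` minus its binary digit sum, and 2^m - 1 has `m` ones. Each halving in
-- the induction drops one of them.
ν-2^∸1 : ∀ m a → suc a ≡ 2 ^ m → ν m a + m ≡ a
ν-2^∸1 zero    zero eq = refl
ν-2^∸1 (suc m) a    eq = begin
  ⌊ a /2⌋ + ν m ⌊ a /2⌋ + suc m  ≡⟨ cong (λ h → h + ν m h + suc m) half ⟩
  b + ν m b + suc m              ≡⟨ shift b (ν m b) m ⟩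
  suc (b + (ν m b + m))          ≡⟨ cong (λ c → suc (b + c)) (ν-2^∸1 m b 1+b≡2^m) ⟩
  suc (b + b)                    ≡⟨ cong suc (2*n≡n+n b) ⟨
  suc (2 * b)                    ≡⟨ a≡1+2b ⟨
  a                              ∎
  where
  open ≡-Reasoning
  b : ℕ
  b = 2 ^ m ∸ 1
  1+b≡2^m : suc b ≡ 2 ^ m
  1+b≡2^m = m+[n∸m]≡n (m^n>0 2 m)
  shift : ∀ x y z → x + y + suc z ≡ suc (x + (y + z))
  shift = solve-∀
  double : ∀ b → 2 * suc b ≡ suc (suc (2 * b))
  double = solve-∀
  a≡1+2b : a ≡ suc (2 * b)
  a≡1+2b = suc-injective (trans eq (trans (cong (2 *_) (sym 1+b≡2^m)) (double b)))
  half : ⌊ a /2⌋ ≡ b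
  half = trans (cong ⌊_/2⌋ a≡1+2b) (⌊1+2n/2⌋≡n b)

2⌊n/2⌋≤n : ∀ n → 2 * ⌊ n /2⌋ ≤ n
2⌊n/2⌋≤n n = begin
  2 * ⌊ n /2⌋          ≡⟨ 2*n≡n+n ⌊ n /2⌋ ⟩
  ⌊ n /2⌋ + ⌊ n /2⌋    ≤⟨ +-monoʳ-≤ ⌊ n /2⌋ (⌊n/2⌋-mono (n≤1+n n)) ⟩
  ⌊ n /2⌋ + _          ≡⟨ ⌊n/2⌋+⌈n/2⌉≡n n ⟩
  n                    ∎
  where open ≤-Reasoning

n<2^n : ∀ n → n < 2 ^ n
n<2^n zero    = s≤s z≤n
n<2^n (suc n) = begin-strict
  suc n          ≤⟨ n<2^n n ⟩
  2 ^ n          <⟨ m<m+n (2 ^ n) (m^n>0 2 n) ⟩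
  2 ^ n + 2 ^ n  ≡⟨ 2*n≡n+n (2 ^ n) ⟨
  2 * 2 ^ n      ∎
  where open ≤-Reasoning

-- Semigroups generated by a sequence with tⱼ₊₁ = 2 tⱼ + 1

module Doubling (t : ℕ → ℕ) (t-suc : ∀ j → t (suc j) ≡ suc (2 * t j)) where

  T : Pred ℕ 0ℓ
  T = ⟨ (λ x → ∃[ j ] x ≡ t j) ⟩

  suc-t : ∀ j → suc (t j) ≡ 2 ^ j * suc (t 0)
  suc-t zero    = sym (*-identityˡ _)
  suc-t (suc j) = begin
    suc (t (suc j))          ≡⟨ cong suc (t-suc j) ⟩
    suc (suc (2 * t j))      ≡⟨ double (t j) ⟩
    2 * suc (t j)            ≡⟨ cong (2 *_) (suc-t j) ⟩
    2 * (2 ^ j * suc (t 0))  ≡⟨ *-assoc 2 (2 ^ j) _ ⟨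
    2 * 2 ^ j * suc (t 0)    ∎
    where
    open ≡-Reasoning
    double : ∀ x → suc (suc (2 * x)) ≡ 2 * suc x
    double = solve-∀

  multiple∈T : ∀ c j → c * t j ∈ T
  multiple∈T zero    j = 0-mem
  multiple∈T (suc c) j = +-mem (gen (j , refl)) (multiple∈T c j)

  -- Replacing two copies of tⱼ by one tⱼ₊₁ raises the sum by 1.
  trade : ∀ j {a b} d → 2 * b ≤ a →
          b * t (suc j) + d + (a ∸ 2 * b) * t j ≡ a * t j + (b + d)
  trade j {a} {b} d 2b≤a = begin
    b * t (suc j) + d + (a ∸ 2 * b) * t j      ≡⟨ cong (λ u → b * u + d + (a ∸ 2 * b) * t j) (t-suc j) ⟩
    b * suc (2 * t j) + d + (a ∸ 2 * b) * t j  ≡⟨ collect b d (a ∸ 2 * b) (t j) ⟩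
    (2 * b + (a ∸ 2 * b)) * t j + (b + d)      ≡⟨ cong (λ c → c * t j + (b + d)) (m+[n∸m]≡n 2b≤a) ⟩
    a * t j + (b + d)                          ∎
    where
    open ≡-Reasoning
    collect : ∀ b d c u → b * suc (2 * u) + d + c * u ≡ (2 * b + c) * u + (b + d)
    collect = solve-∀

  -- Membership criterion

  -- Start from `a` copies of `t j` and gain 1 per trade. If `e ≤ ⌊ a /2⌋`, trading `e` pairs
  -- suffices. Otherwise trade all pairs and obtain the rest of `e` by trading among the `⌊ a /2⌋`
  -- new copies of `t (suc j)`.
  ≤ν⇒∈T : ∀ m j {a e} → e ≤ ν m a → a * t j + e ∈ T
  ≤ν⇒∈T zero    j {a} z≤n = +-mem (multiple∈T a j) 0-mem
  ≤ν⇒∈T (suc m) j {a} {e} e≤ with ≤-total e ⌊ a /2⌋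
  ... | inj₁ e≤h = subst (_∈ T)
    (trans (trade j 0 (≤-trans (*-monoʳ-≤ 2 e≤h) (2⌊n/2⌋≤n a)))
           (cong (a * t j +_) (+-identityʳ e)))
    (+-mem (≤ν⇒∈T m (suc j) {e} z≤n) (multiple∈T (a ∸ 2 * e) j))
  ... | inj₂ h≤e = subst (_∈ T)
    (trans (trade j (e ∸ ⌊ a /2⌋) (2⌊n/2⌋≤n a))
           (cong (a * t j +_) (m+[n∸m]≡n h≤e)))
    (+-mem (≤ν⇒∈T m (suc j) (m≤n+o⇒m∸n≤o _ ⌊ a /2⌋ e≤))
           (multiple∈T (a ∸ 2 * ⌊ a /2⌋) j))

  -- Here `a` adds up the powers 2^j of the generators used, and `e` is `a` minus their number. The
  -- bound is kept for every sufficient depth `m`, so that two summands can both be bounded at a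
  -- depth that suits their sum.
  ∈T⇒≤ν : ∀ {x} → x ∈ T →
          ∃[ a ] ∃[ e ] (x ≡ a * t 0 + e × (∀ m → a < 2 ^ m → e ≤ ν m a))
  -- For one generator `e` is 2^j - 1, written as `ν j (2 ^ j)`.
  ∈T⇒≤ν (gen (j , refl)) = 2 ^ j , ν j (2 ^ j) , suc-injective expand , bound
    where
    expand : suc (t j) ≡ suc (2 ^ j * t 0 + ν j (2 ^ j))
    expand = begin
      suc (t j)                            ≡⟨ suc-t j ⟩
      2 ^ j * suc (t 0)                    ≡⟨ *-suc (2 ^ j) (t 0) ⟩
      2 ^ j + 2 ^ j * t 0                  ≡⟨ +-comm (2 ^ j) _ ⟩
      2 ^ j * t 0 + 2 ^ j                  ≡⟨ cong (2 ^ j * t 0 +_) (suc-ν-2^ {j} ≤-refl) ⟨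
      2 ^ j * t 0 + suc (ν j (2 ^ j))      ≡⟨ +-suc (2 ^ j * t 0) _ ⟩
      suc (2 ^ j * t 0 + ν j (2 ^ j))      ∎
      where open ≡-Reasoning
    bound : ∀ m → 2 ^ j < 2 ^ m → ν j (2 ^ j) ≤ ν m (2 ^ j)
    bound m 2^j<2^m = s≤s⁻¹ (≤-reflexive
      (trans (suc-ν-2^ {j} ≤-refl) (sym (suc-ν-2^ j≤m))))
      where
      j≤m : j ≤ m
      j≤m = ≮⇒≥ λ m<j → <⇒≱ 2^j<2^m (^-monoʳ-≤ 2 (<⇒≤ m<j))
  ∈T⇒≤ν 0-mem = 0 , 0 , refl , λ _ _ → z≤n
  ∈T⇒≤ν (+-mem x∈T y∈T)
    with a , d , refl , d≤ ← ∈T⇒≤ν x∈T | b , e , refl , e≤ ← ∈T⇒≤ν y∈T =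
    a + b , d + e , collect a b d e (t 0) , λ m a+b<2^m → ≤-trans
      (+-mono-≤ (d≤ m (≤-<-trans (m≤m+n a b) a+b<2^m))
                (e≤ m (≤-<-trans (m≤n+m b a) a+b<2^m)))
      (ν-superadditive m a b)
    where
    collect : ∀ a b d e u → (a * u + d) + (b * u + e) ≡ (a + b) * u + (d + e)
    collect = solve-∀

  -- A representation `a * t 0 + e` of the element has `a ≤ q`, since `suc q * t 0` already exceeds
  -- it. Lowering `q` to `a` only enlarges the remainder, so `r ≤ e`, and monotonicity of `ν`
  -- finishes.
  ∈T⇔≤ν : ∀ m {q r} → q < 2 ^ m → r < t 0 → (q * t 0 + r ∈ T) ⇔ (r ≤ ν m q)
  ∈T⇔≤ν m {q} {r} q<2^m r<t₀ = mk⇔ to (≤ν⇒∈T m 0)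
    where
    open ≤-Reasoning
    to : q * t 0 + r ∈ T → r ≤ ν m q
    to x∈T with a , e , eq , e≤ ← ∈T⇒≤ν x∈T = begin
      r      ≤⟨ +-cancelˡ-≤ (q * t 0) r e (begin
                q * t 0 + r  ≡⟨ eq ⟩
                a * t 0 + e  ≤⟨ +-monoˡ-≤ e (*-monoˡ-≤ (t 0) a≤q) ⟩
                q * t 0 + e  ∎) ⟩
      e      ≤⟨ e≤ m (≤-<-trans a≤q q<2^m) ⟩
      ν m a  ≤⟨ ν-mono m a≤q ⟩
      ν m q  ∎
      where
      a≤q : a ≤ q
      a≤q = ≮⇒≥ λ q<a → <-irrefl refl (begin-strict
        q * t 0 + r    <⟨ +-monoʳ-< (q * t 0) r<t₀ ⟩
        q * t 0 + t 0  ≡⟨ +-comm (q * t 0) (t 0) ⟩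
        suc q * t 0    ≤⟨ *-monoˡ-≤ (t 0) q<a ⟩
        a * t 0        ≤⟨ m≤m+n (a * t 0) e ⟩
        a * t 0 + e    ≡⟨ eq ⟨
        q * t 0 + r    ∎)

  -- Decidability and the Frobenius number

  module _ .{{_ : NonZero (t 0)}} where

    divMod : ∀ x → x / t 0 * t 0 + x % t 0 ≡ x
    divMod x = trans (+-comm (x / t 0 * t 0) _) (sym (m≡m%n+[m/n]*n x (t 0)))

    T? : Decidable T
    T? x = map′ (subst (_∈ T) (divMod x) ∘ from) (to ∘ subst (_∈ T) (sym (divMod x)))
                -- The quotient q itself serves as depth, because q < 2^q.
                (x % t 0 ≤? ν (x / t 0) (x / t 0))
      where open Equivalence (∈T⇔≤ν (x / t 0) (n<2^n (x / t 0)) (m%n<n x (t 0)))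

    -- `u` is the largest remainder. `ν m p < u` makes it a gap at quotient `p`, while `u ≤ p` and
    -- `ν m (2 ^ m) = p` put every remainder in `T` from quotient `2 ^ m` on.
    frobenius : ∀ m {p u} → suc p ≡ 2 ^ m → suc u ≡ t 0 → ν m p < u → u ≤ p →
                IsFrobeniusNumber T (p * t 0 + u)
    frobenius m {p} {u} 1+p≡2^m 1+u≡t₀ νp<u u≤p = gap , bound
      where
      open ≤-Reasoning
      gap : p * t 0 + u ∉ T
      gap = <⇒≱ νp<u ∘
        Equivalence.to (∈T⇔≤ν m (≤-reflexive 1+p≡2^m) (≤-reflexive 1+u≡t₀))

      remainder≤ : ∀ x → x % t 0 ≤ u
      remainder≤ x = s≤s⁻¹ (≤-trans (m%n<n x (t 0)) (≤-reflexive (sym 1+u≡t₀)))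

      bound : ∀ x → x ∈ ∁ T → x ≤ p * t 0 + u
      -- The quotient may be so large that `ν m` cuts terms off; `≤ν⇒∈T` accepts the truncated sum.
      bound x x∉T = ≮⇒≥ λ x> → x∉T (subst (_∈ T) (divMod x) (≤ν⇒∈T m 0 (begin
          x % t 0        ≤⟨ remainder≤ x ⟩
          u              ≤⟨ u≤p ⟩
          p              ≡⟨ suc-injective (trans 1+p≡2^m (sym (suc-ν-2^ {m} ≤-refl))) ⟩
          ν m (2 ^ m)    ≤⟨ ν-mono m (2^m≤quotient x>) ⟩
          ν m (x / t 0)  ∎)))
        where
        2^m≤quotient : p * t 0 + u < x → 2 ^ m ≤ x / t 0
        2^m≤quotient x> = subst (_≤ x / t 0) 1+p≡2^m (≰⇒> λ q≤p → <-irrefl refl (begin-strict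
          x                            ≡⟨ divMod x ⟨
          x / t 0 * t 0 + x % t 0      ≤⟨ +-mono-≤ (*-monoˡ-≤ (t 0) q≤p) (remainder≤ x) ⟩
          p * t 0 + u                  <⟨ x> ⟩
          x                            ∎))

  isNumericalSemigroup : .{{_ : NonZero (t 0)}} → ∀ {f} →
                         IsFrobeniusNumber T f → IsNumericalSemigroup T
  isNumericalSemigroup {f} frob = record
    { 0∈S      = 0-mem
    ; +-closed = +-mem
    ; cofinite = bounded⇒finite (¬? ∘ T?) f (proj₂ frob)
    }

  -- Sums of consecutive generators

  -- Each summand absorbs one unit: 2 t_j + 1 + t_(j+1) = 2 t_(j+1). The function `g` is abstract
  -- because `applyUpTo` shifts its argument at every step.
  telescope : ∀ c j g → (∀ i → g i ≡ t (suc j + i)) →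
              2 * t j + sum (applyUpTo g c) + c ≡ 2 * t (j + c)
  telescope zero    j g g≡ = begin
    2 * t j + 0 + 0  ≡⟨ trans (+-identityʳ _) (+-identityʳ _) ⟩
    2 * t j          ≡⟨ cong (λ i → 2 * t i) (+-identityʳ j) ⟨
    2 * t (j + 0)    ∎
    where open ≡-Reasoning
  telescope (suc c) j g g≡ = begin
    2 * t j + (g 0 + rest) + suc c          ≡⟨ cong (λ u → 2 * t j + (u + rest) + suc c) g0≡ ⟩
    2 * t j + (t (suc j) + rest) + suc c    ≡⟨ shift (2 * t j) (t (suc j)) rest c ⟩
    suc (2 * t j) + t (suc j) + rest + c    ≡⟨ cong (λ u → u + t (suc j) + rest + c) (t-suc j) ⟨
    t (suc j) + t (suc j) + rest + c        ≡⟨ cong (λ u → u + rest + c) (2*n≡n+n (t (suc j))) ⟨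
    2 * t (suc j) + rest + c                ≡⟨ telescope c (suc j) (g ∘ suc) (λ i → trans (g≡ (suc i)) (cong t (+-suc (suc j) i))) ⟩
    2 * t (suc j + c)                       ≡⟨ cong (λ i → 2 * t i) (+-suc j c) ⟨
    2 * t (j + suc c)                       ∎
    where
    open ≡-Reasoning
    rest : ℕ
    rest = sum (applyUpTo (g ∘ suc) c)
    g0≡ : g 0 ≡ t (suc j)
    g0≡ = trans (g≡ 0) (cong t (+-identityʳ (suc j)))
    shift : ∀ x y z w → x + (y + z) + suc w ≡ suc x + y + z + w
    shift = solve-∀

  -- The telescoped sum is 2 t_(m-1), and the extra 1 turns it into t_m.
  ∑-closed : ∀ {m} c → c < m →
             suc (2 * t (m ∸ c ∸ 1) + ∑[ m ∸ c ⋯ m ∸ 1 ] t + c) ≡ t m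
  ∑-closed {m} c c<m = go (sym m≡)
    where
    m≡ : suc (m ∸ suc c + c) ≡ m
    m≡ = trans (sym (+-suc _ c)) (m∸n+n≡m c<m)
    -- With `m` replaced by `suc (j + c)`, the index `m ∸ c ∸ 1` becomes `j` and the sum has exactly
    -- `c` terms.
    go : ∀ {m j} → m ≡ suc (j + c) →
         suc (2 * t (m ∸ c ∸ 1) + ∑[ m ∸ c ⋯ m ∸ 1 ] t + c) ≡ t m
    go {j = j} refl rewrite m+n∸n≡m (suc j) c | m+n∸m≡n j c =
      trans (cong suc (telescope c j _ (λ _ → refl))) (sym (t-suc (j + c)))

-- The semigroup of the theorem

suc-s : ∀ k n j → k ≥ 1 → suc (s k n j) ≡ (2 ^ k ∸ 1) * 2 ^ (n + j)
suc-s k n j 1≤k = m+[n∸m]≡n (*-mono-≤ (m+n≤o⇒m≤o∸n 1 (^-monoʳ-≤ 2 1≤k)) (m^n>0 2 (n + j)))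

s-suc : ∀ k n → k ≥ 1 → ∀ j → s k n (suc j) ≡ suc (2 * s k n j)
s-suc k n 1≤k j = suc-injective (begin
  suc (s k n (suc j))              ≡⟨ suc-s k n (suc j) 1≤k ⟩
  (2 ^ k ∸ 1) * 2 ^ (n + suc j)    ≡⟨ cong (λ i → (2 ^ k ∸ 1) * 2 ^ i) (+-suc n j) ⟩
  (2 ^ k ∸ 1) * (2 * 2 ^ (n + j))  ≡⟨ swap (2 ^ k ∸ 1) (2 ^ (n + j)) ⟩
  2 * ((2 ^ k ∸ 1) * 2 ^ (n + j))  ≡⟨ cong (2 *_) (suc-s k n j 1≤k) ⟨
  2 * suc (s k n j)                ≡⟨ double (s k n j) ⟩
  suc (suc (2 * s k n j))          ∎)
  where
  open ≡-Reasoning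
  swap : ∀ x y → x * (2 * y) ≡ 2 * (x * y)
  swap = solve-∀
  double : ∀ x → 2 * suc x ≡ suc (suc (2 * x))
  double = solve-∀

s₀≡ : ∀ k n → s k n 0 ≡ 2 ^ (n + k) ∸ 2 ^ n ∸ 1
s₀≡ k n = cong (_∸ 1) (begin
  (2 ^ k ∸ 1) * 2 ^ (n + 0)    ≡⟨ cong (λ i → (2 ^ k ∸ 1) * 2 ^ i) (+-identityʳ n) ⟩
  (2 ^ k ∸ 1) * 2 ^ n          ≡⟨ *-distribʳ-∸ (2 ^ n) (2 ^ k) 1 ⟩
  2 ^ k * 2 ^ n ∸ 1 * 2 ^ n    ≡⟨ cong₂ _∸_ (trans (*-comm (2 ^ k) (2 ^ n)) (sym (^-distribˡ-+-* 2 n k))) (*-identityˡ (2 ^ n)) ⟩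
  2 ^ (n + k) ∸ 2 ^ n          ∎)
  where open ≡-Reasoning

-- Factor `P = 2 ^ (n + k)` out of the first three terms: the cofactor `P ∸ 2 ^ n ∸ 1` is `s k n 0`.
frobenius-formula : ∀ k n → 2 ^ (2 * n + 2 * k) ∸ 2 ^ (2 * n + k) ∸ 2 ^ (n + k) ∸ 1
                            ≡ 2 ^ (n + k) * s k n 0 ∸ 1
frobenius-formula k n = cong (_∸ 1) (begin
  2 ^ (2 * n + 2 * k) ∸ 2 ^ (2 * n + k) ∸ P  ≡⟨ cong₂ (λ x y → x ∸ y ∸ P) (square n k) (mixed n k) ⟩
  P * P ∸ P * 2 ^ n ∸ P                      ≡⟨ cong (_∸ P) (*-distribˡ-∸ P P (2 ^ n)) ⟨
  P * (P ∸ 2 ^ n) ∸ P                        ≡⟨ cong (P * (P ∸ 2 ^ n) ∸_) (*-identityʳ P) ⟨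
  P * (P ∸ 2 ^ n) ∸ P * 1                    ≡⟨ *-distribˡ-∸ P (P ∸ 2 ^ n) 1 ⟨
  P * (P ∸ 2 ^ n ∸ 1)                        ≡⟨ cong (P *_) (s₀≡ k n) ⟨
  P * s k n 0                                ∎)
  where
  open ≡-Reasoning
  P : ℕ
  P = 2 ^ (n + k)
  exponent₁ : ∀ n k → 2 * n + 2 * k ≡ (n + k) + (n + k)
  exponent₁ = solve-∀
  exponent₂ : ∀ n k → 2 * n + k ≡ (n + k) + n
  exponent₂ = solve-∀
  square : ∀ n k → 2 ^ (2 * n + 2 * k) ≡ 2 ^ (n + k) * 2 ^ (n + k)
  square n k = trans (cong (2 ^_) (exponent₁ n k)) (^-distribˡ-+-* 2 (n + k) (n + k))
  mixed : ∀ n k → 2 ^ (2 * n + k) ≡ 2 ^ (n + k) * 2 ^ n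
  mixed n k = trans (cong (2 ^_) (exponent₂ n k)) (^-distribˡ-+-* 2 (n + k) n)

mainTheorem9 : (k n : ℕ) → k ≥ 2 → n ≥ 1 → k > 2 ^ n →
    IsNumericalSemigroup (S k n)
    × IsMax (Ap (S k n) (s k n 0))
    (2 * s k n (n + k ∸ 2 ^ n ∸ 1) + ∑[ n + k ∸ 2 ^ n ⋯ n + k ∸ 1 ] (s k n))
    × IsFrobeniusNumber (S k n)
    (2 ^ (2 * n + 2 * k) ∸ 2 ^ (2 * n + k) ∸ 2 ^ (n + k) ∸ 1)
mainTheorem9 k n k≥2 n≥1 k>2^n =
  isNumericalSemigroup frob ,
  subst (IsMax (Ap (S k n) s₀)) (sym apéry≡) (frobenius⇒maxAp T? frob 0<s₀) ,
  subst (IsFrobeniusNumber (S k n)) (sym frobenius≡) frob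
  where
  1≤k : 1 ≤ k
  1≤k = ≤-trans (n≤1+n 1) k≥2

  open Doubling (s k n) (s-suc k n 1≤k)

  m c s₀ p u : ℕ
  m  = n + k
  c  = 2 ^ n
  s₀ = s k n 0
  p  = 2 ^ m ∸ 1
  u  = s₀ ∸ 1

  -- Since `ν m p` is p - m and `u` is p - (c + 1), this is exactly the condition `ν m p < u`; the
  -- hypothesis `k > 2 ^ n` enters here.
  1+c<m : suc c < m
  1+c<m = +-mono-≤ n≥1 k>2^n

  1+p≡2^m : suc p ≡ 2 ^ m
  1+p≡2^m = m+[n∸m]≡n (m^n>0 2 m)

  νp+m≡p : ν m p + m ≡ p
  νp+m≡p = ν-2^∸1 m p 1+p≡2^m

  u≡ : u ≡ p ∸ suc c
  u≡ = begin
    s₀ ∸ 1                   ≡⟨ cong (_∸ 1) (s₀≡ k n) ⟩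
    2 ^ m ∸ c ∸ 1 ∸ 1        ≡⟨ cong (λ x → x ∸ c ∸ 1 ∸ 1) 1+p≡2^m ⟨
    suc p ∸ c ∸ 1 ∸ 1        ≡⟨ cong (_∸ 1) (trans (∸-+-assoc (suc p) c 1) (cong (suc p ∸_) (+-comm c 1))) ⟩
    p ∸ c ∸ 1                ≡⟨ trans (∸-+-assoc p c 1) (cong (p ∸_) (+-comm c 1)) ⟩
    p ∸ suc c                ∎
    where open ≡-Reasoning

  νp<u : ν m p < u
  νp<u = subst (ν m p <_) (sym u≡) (m+n≤o⇒m≤o∸n (suc (ν m p)) (begin
    suc (ν m p) + suc c  ≡⟨ +-suc (ν m p) (suc c) ⟨
    ν m p + suc (suc c)  ≤⟨ +-monoʳ-≤ (ν m p) 1+c<m ⟩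
    ν m p + m            ≡⟨ νp+m≡p ⟩
    p                    ∎))
    where open ≤-Reasoning

  u+1+c≡p : u + suc c ≡ p
  u+1+c≡p = trans (cong (_+ suc c) u≡) (m∸n+n≡m
    (≤-trans (<⇒≤ 1+c<m) (≤-trans (m≤n+m m (ν m p)) (≤-reflexive νp+m≡p))))

  u≤p : u ≤ p
  u≤p = ≤-trans (≤-reflexive u≡) (m∸n≤m p (suc c))

  0<s₀ : 0 < s₀
  0<s₀ = ≤-trans (≤-<-trans z≤n νp<u) (m∸n≤m s₀ 1)

  1+u≡s₀ : suc u ≡ s₀
  1+u≡s₀ = m+[n∸m]≡n 0<s₀

  instance
    s₀-nonZero : NonZero s₀
    s₀-nonZero = >-nonZero 0<s₀

  frob : IsFrobeniusNumber (S k n) (p * s₀ + u)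
  frob = frobenius m 1+p≡2^m 1+u≡s₀ νp<u u≤p

  frobenius≡ : 2 ^ (2 * n + 2 * k) ∸ 2 ^ (2 * n + k) ∸ 2 ^ (n + k) ∸ 1 ≡ p * s₀ + u
  frobenius≡ = begin
    2 ^ (2 * n + 2 * k) ∸ 2 ^ (2 * n + k) ∸ 2 ^ (n + k) ∸ 1
                       ≡⟨ frobenius-formula k n ⟩
    2 ^ m * s₀ ∸ 1     ≡⟨ cong (λ x → x * s₀ ∸ 1) 1+p≡2^m ⟨
    s₀ + p * s₀ ∸ 1    ≡⟨ cong (_∸ 1) (+-comm s₀ (p * s₀)) ⟩
    p * s₀ + s₀ ∸ 1    ≡⟨ +-∸-assoc (p * s₀) 0<s₀ ⟩
    p * s₀ + u         ∎
    where open ≡-Reasoning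

  apéry≡ : 2 * s k n (m ∸ c ∸ 1) + ∑[ m ∸ c ⋯ m ∸ 1 ] (s k n) ≡ (p * s₀ + u) + s₀
  -- After adding `c + 2`, both sides equal `2 ^ m * suc s₀`: on the left `c + 1` completes the sum
  -- to `s k n m`, and one more gives its successor.
  apéry≡ = +-cancelʳ-≡ (suc (suc c)) _ _ (begin
    A + suc (suc c)                  ≡⟨ trans (+-suc A (suc c)) (cong suc (+-suc A c)) ⟩
    suc (suc (A + c))                ≡⟨ cong suc (∑-closed c (<⇒≤ 1+c<m)) ⟩
    suc (s k n m)                    ≡⟨ suc-t m ⟩
    2 ^ m * suc s₀                   ≡⟨ cong (_* suc s₀) 1+p≡2^m ⟨
    suc p * suc s₀                   ≡⟨ expand p s₀ ⟩
    p * s₀ + s₀ + suc p              ≡⟨ cong (λ x → p * s₀ + s₀ + suc x) u+1+c≡p ⟨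
    p * s₀ + s₀ + suc (u + suc c)    ≡⟨ regroup (p * s₀) s₀ u c ⟩
    p * s₀ + u + s₀ + suc (suc c)    ∎)
    where
    open ≡-Reasoning
    A : ℕ
    A = 2 * s k n (m ∸ c ∸ 1) + ∑[ m ∸ c ⋯ m ∸ 1 ] (s k n)
    expand : ∀ p v → suc p * suc v ≡ p * v + v + suc p
    expand = solve-∀
    regroup : ∀ x v u c → x + v + suc (u + suc c) ≡ x + u + v + suc (suc c)
    regroup = solve-∀
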